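{- $$|AI_n(3421,4312)|=|RAI_n(3421,4312)|=F_{n-1},$$ where $F_k$ is the $k$-th Fibonacci number.
   Context: Let $S_n$ be the set of permutations $\pi=\pi_1\ldots\pi_n$ of $\{1,\ldots,n\}$. A permutation is alternating if, for all $1\le i\le n-1$, $\pi_i<\pi_{i+1}$ if and only if $i$ is odd; it is reverse alternating if, for all $1\le i\le n-1$, $\pi_i>\pi_{i+1}$ if and only if $i$ is odd. $AI_n$ (resp. $RAI_n$) is the set of alternating (resp. reverse alternating) involutions ($\pi=\pi^{ -1}$) in $S_n$. A permutation $\pi\in S_n$ avoids the pattern $\tau\in S_k$ if there are no indices $i_1<\cdots<i_k$ such that $\pi_{i_1}\ldots\pi_{i_k}$ is order-isomorphic to $\tau$; $AI_n(\sigma,\tau)$ and $RAI_n(\sigma,\tau)$ are the subsets of elements avoiding both $\sigma$ and $\tau$. (Since $4312=3421^{ -1}$, an involution avoids both patterns if and only if it avoids either one.) The Fibonacci numbers $F_k$ are those of OEIS sequence A000045: $F_0=0$, $F_1=1$, $F_k=F_{k-1}+F_{k-2}$.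
   Formalization: The identity is proved for all n ≥ 2; at n = 1 it fails, since both sets contain the single permutation 1 while F_0 = 0, and for n = 0 the index n−1 is negative. -}

module Defs where

open import Data.Fin using (Fin; toℕ; _<_; _>_)
open import Data.Fin.Patterns using (0F; 1F; 2F; 3F)
open import Data.Fin.Permutation using (Permutation′; permutation; _⟨$⟩ʳ_; _≈_; flip)
open import Data.Nat using (ℕ; zero; suc; _+_)
open import Data.Nat.Divisibility using (_∤_)
open import Data.Product using (∃; ∃-syntax; _×_; proj₁)
open import Data.Vec using (lookup; _∷_; [])
open import Function.Bundles using (Inverse; _⇔_)
open import Level using (0ℓ)
open import Relation.Binary.Bundles using (Setoid)
open import Relation.Binary.Core using (_Preserves_⟶_)
open import Relation.Binary.PropositionalEquality using (_≡_; refl; setoid; _→-setoid_)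
import Relation.Binary.Construct.On as On
open import Relation.Nullary using (¬_)

-- Permutations act on Fin n = {0,…,n-1}, so the one-line entry in position
-- suc (toℕ i) of {1,…,n} is suc (toℕ (π ⟨$⟩ʳ i)).  In the two definitions below
-- i and j range over all pairs of adjacent positions.

Alternating : ∀ {n} → Permutation′ n → Set
Alternating {n} π = ∀ (i j : Fin n) → toℕ j ≡ suc (toℕ i) →
  (π ⟨$⟩ʳ i < π ⟨$⟩ʳ j) ⇔ (2 ∤ suc (toℕ i))

ReverseAlternating : ∀ {n} → Permutation′ n → Set
ReverseAlternating {n} π = ∀ (i j : Fin n) → toℕ j ≡ suc (toℕ i) →
  (π ⟨$⟩ʳ i > π ⟨$⟩ʳ j) ⇔ (2 ∤ suc (toℕ i))

Involution : ∀ {n} → Permutation′ n → Set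
Involution π = π ≈ flip π

-- ι lists the positions i₁ < ⋯ < iₖ of the occurrence.
Contains : ∀ {n k} → Permutation′ n → Permutation′ k → Set
Contains {n} {k} π τ = ∃[ ι ]
  ι Preserves _<_ {k} {k} ⟶ _<_ {n} {n} ×
  (∀ a b → (π ⟨$⟩ʳ ι a < π ⟨$⟩ʳ ι b) ⇔ (τ ⟨$⟩ʳ a < τ ⟨$⟩ʳ b))

Avoids : ∀ {n k} → Permutation′ n → Permutation′ k → Set
Avoids π τ = ¬ Contains π τ

-- The set of permutations satisfying P: elements are equal when the underlying
-- permutations agree pointwise, whatever the proofs of P and the stored inverses.
⟪_⟫ : ∀ {n} → (Permutation′ n → Set) → Setoid 0ℓ 0ℓ
⟪_⟫ {n} P = On.setoid {B = ∃ P} (Fin n →-setoid Fin n) (λ p → proj₁ p ⟨$⟩ʳ_)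

AI : ∀ n {k l} → Permutation′ k → Permutation′ l → Setoid 0ℓ 0ℓ
AI n σ τ = ⟪ (λ (π : Permutation′ n) →
  Alternating π × Involution π × Avoids π σ × Avoids π τ) ⟫

RAI : ∀ n {k l} → Permutation′ k → Permutation′ l → Setoid 0ℓ 0ℓ
RAI n σ τ = ⟪ (λ (π : Permutation′ n) →
  ReverseAlternating π × Involution π × Avoids π σ × Avoids π τ) ⟫

HasCardinality : Setoid 0ℓ 0ℓ → ℕ → Set
HasCardinality S k = Inverse S (setoid (Fin k))

-- The patterns 3421 and 4312 with each entry lowered by one; they are inverse
-- to each other.
p3421 : Permutation′ 4
p3421 = permutation
  (lookup (2F ∷ 3F ∷ 1F ∷ 0F ∷ []))
  (lookup (3F ∷ 2F ∷ 0F ∷ 1F ∷ []))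
  (λ { 0F → refl ; 1F → refl ; 2F → refl ; 3F → refl })
  (λ { 0F → refl ; 1F → refl ; 2F → refl ; 3F → refl })

p4312 : Permutation′ 4
p4312 = permutation
  (lookup (3F ∷ 2F ∷ 0F ∷ 1F ∷ []))
  (lookup (2F ∷ 3F ∷ 1F ∷ 0F ∷ []))
  (λ { 0F → refl ; 1F → refl ; 2F → refl ; 3F → refl })
  (λ { 0F → refl ; 1F → refl ; 2F → refl ; 3F → refl })

F : ℕ → ℕ
F zero          = 0
F (suc zero)    = 1
F (suc (suc k)) = F (suc k) + F k

{-# OPTIONS --safe #-}
module Submission where

-- View an involution as a set of arcs and fixed points.  Its zigzag shape cuts
-- the positions into descending pairs (p, p + 1), up to one single position at
-- either end.  Avoiding 3421 forces at most one arc to pass over each gap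
-- between pairs, so reading from left to right only four kinds of pair occur:
-- an adjacent transposition, or the left (right) end of a long arc next to a
-- fixed point, or the right end of one long arc next to the left end of another.
-- Such words determine the involution, every word gives a 3421-avoiding one,
-- and words are counted by a two-state recursion of Fibonacci type.

-- Avoidance alone does not limit the arcs over a gap: the involution 3412 has two over its middle
-- gap. It is the zigzag shape that helps. If a pair starts a second arc while an earlier one stays
-- open, or starts two at once, then the descent inside the pair or the ascent after it supplies
-- what is missing from a 3421. With one arc open at a time, a right end has only one possible left
-- end, so words store no positions. `Follows` relates a function to a word and is where both
-- translations meet: `parse` and `value-follows` establish it, and `unique` and `agree` make the
-- translations mutually inverse.

open import Defs
open import Data.Bool using (Bool; true; false; not)
open import Data.Bool.Properties using (not-involutive)
open import Data.Empty using (⊥; ⊥-elim)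
open import Data.Fin as Fin using (Fin; toℕ; fromℕ<)
open import Data.Fin.Patterns using (0F; 1F; 2F; 3F)
open import Data.Fin.Permutation using (Permutation′; permutation; _⟨$⟩ʳ_; _⟨$⟩ˡ_; inverseʳ; inverseˡ)
open import Data.Fin.Properties using (+↔⊎; toℕ<n; toℕ-fromℕ<; fromℕ<-toℕ; toℕ-injective)
open import Data.Nat using (ℕ; zero; suc; _+_; _∸_; _≤_; _<_; z≤n; s≤s; _<?_)
open import Data.Nat.Divisibility using (_∣_; _∤_; divides; ∣m+n∣m⇒∣n; ∣m∣n⇒∣m+n; ∣-refl)
open import Data.Nat.Properties
open import Data.Product using (Σ; ∃; ∃-syntax; _×_; _,_; proj₁; proj₂)
open import Data.Sum using (_⊎_; inj₁; inj₂)
open import Data.Sum.Function.Propositional using (_⊎-↔_)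
open import Data.Unit using (⊤; tt)
open import Data.Vec using (lookup; _∷_; [])
open import Function using (_∘_; _↔_; mk↔ₛ′; case_of_)
open import Function.Construct.Composition using (inverse)
open import Function.Bundles using (Inverse; mk⇔; Equivalence)
open import Function.Properties.Inverse using (↔-trans; ↔-sym)
open import Relation.Binary.Definitions using (tri<; tri≈; tri>)
open import Relation.Binary.PropositionalEquality
open import Relation.Nullary using (yes; no; contradiction)

-- Words for the last k positions: Free when no arc comes in from the left, Under
-- when one does, Fresh when moreover that arc starts at a single position 0 just
-- before, or in a preceding pair whose other entry ends an earlier arc.  Only a
-- Fresh arc may end in a single last position, for otherwise the ascent in front
-- of that position fails.
data Free : ℕ → Set
data Under : ℕ → Set
data Fresh : ℕ → Set

data Free where
  done : Free 0
  fix  : Free 1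
  swap : ∀ {k} → Free k → Free (2 + k)
  opening : ∀ {k} → Under k → Free (2 + k)

data Under where
  swap  : ∀ {k} → Under k → Under (2 + k)
  close : ∀ {k} → Free k → Under (2 + k)
  cross : ∀ {k} → Fresh k → Under (2 + k)

data Fresh where
  fin  : Fresh 1
  cont : ∀ {k} → Under k → Fresh k

-- The Boolean tells whether position 0 starts a descending pair.  If not, and
-- position 0 is not fixed, then its arc has to end at 2 while another starts at 1.
data Start : Bool → ℕ → Set where
  plain  : ∀ {n} → Free n → Start true n
  fixed  : ∀ {k} → Free k → Start false (1 + k)
  linked : ∀ {k} → Fresh k → Start false (3 + k)

-- Counting words

under-split : ∀ {k} → Under (2 + k) ↔ ((Under k ⊎ Free k) ⊎ Fresh k)
under-split = mk↔ₛ′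
  (λ { (swap w) → inj₁ (inj₁ w) ; (close w) → inj₁ (inj₂ w) ; (cross w) → inj₂ w })
  (λ { (inj₁ (inj₁ w)) → swap w ; (inj₁ (inj₂ w)) → close w ; (inj₂ w) → cross w })
  (λ { (inj₁ (inj₁ w)) → refl ; (inj₁ (inj₂ w)) → refl ; (inj₂ w) → refl })
  (λ { (swap w) → refl ; (close w) → refl ; (cross w) → refl })

free-split : ∀ {k} → Free (2 + k) ↔ (Under k ⊎ Free k)
free-split = mk↔ₛ′
  (λ { (swap w) → inj₂ w ; (opening w) → inj₁ w })
  (λ { (inj₁ w) → opening w ; (inj₂ w) → swap w })
  (λ { (inj₁ w) → refl ; (inj₂ w) → refl })
  (λ { (swap w) → refl ; (opening w) → refl })

fresh-under : ∀ {k} → Fresh (2 + k) ↔ Under (2 + k)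
fresh-under = mk↔ₛ′ (λ { (cont w) → w }) cont (λ _ → refl) (λ { (cont w) → refl })

singleton↔ : ∀ {A : Set} (a : A) → (∀ x → a ≡ x) → A ↔ Fin 1
singleton↔ a h = mk↔ₛ′ (λ _ → 0F) (λ _ → a) (λ { 0F → refl ; (Fin.suc ()) }) h

sum↔ : ∀ {A B : Set} {m n} → A ↔ Fin m → B ↔ Fin n → (A ⊎ B) ↔ Fin (m + n)
sum↔ e g = ↔-trans (e ⊎-↔ g) (↔-sym +↔⊎)

mutual
  -- The sum is counted because its formula is uniform. Separately, `F k` for `Under k` and
  -- `F (k - 1)` for `Free k` both fail at k = 1, where the first has no element and the second has
  -- one; the errors cancel.
  card-either : ∀ k → (Under k ⊎ Free k) ↔ Fin (F (1 + k))
  card-either 0 = singleton↔ (inj₂ done) λ { (inj₂ done) → refl ; (inj₁ ()) }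
  card-either 1 = singleton↔ (inj₂ fix) λ { (inj₂ fix) → refl ; (inj₁ ()) }
  card-either (suc (suc k)) = sum↔ (card-under k) (card-free k)

  card-under : ∀ k → Under (2 + k) ↔ Fin (F (2 + k))
  card-under k = ↔-trans under-split (sum↔ (card-either k) (card-fresh k))

  card-free : ∀ k → Free (2 + k) ↔ Fin (F (1 + k))
  card-free k = ↔-trans free-split (card-either k)

  -- The word `fin` makes up for the emptiness of `Under 1`, so the formula holds from k = 0 on.
  card-fresh : ∀ k → Fresh k ↔ Fin (F k)
  card-fresh 0 = mk↔ₛ′ (λ { (cont ()) }) (λ ()) (λ ()) (λ { (cont ()) })
  card-fresh 1 = singleton↔ fin λ { fin → refl ; (cont ()) }
  card-fresh (suc (suc k)) = ↔-trans fresh-under (card-under k)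

card-start : ∀ b k → Start b (2 + k) ↔ Fin (F (1 + k))
card-start true k = ↔-trans
  (mk↔ₛ′ (λ { (plain w) → w }) plain (λ _ → refl) (λ { (plain w) → refl }))
  (card-free k)
card-start false 0 = singleton↔ (fixed fix) λ { (fixed fix) → refl }
card-start false (suc k) = ↔-trans
  (mk↔ₛ′
    (λ { (fixed w) → inj₁ w ; (linked w) → inj₂ w })
    (λ { (inj₁ w) → fixed w ; (inj₂ w) → linked w })
    (λ { (inj₁ w) → refl ; (inj₂ w) → refl })
    (λ { (fixed w) → refl ; (linked w) → refl }))
  (sum↔ (card-free k) (card-fresh k))

-- Involutions described by words

-- In Under and Fresh words, o is the left end of the incoming arc.
module _ (f : ℕ → ℕ) where
  Arc : ℕ → ℕ → Set
  Arc i j = f i ≡ j × f j ≡ i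

  -- A long arc is asserted only where it ends, when both ends are at hand; until then its left end
  -- is carried along as `o`.
  FollowsFree : ∀ {k} → Free k → ℕ → Set
  FollowsUnder : ∀ {k} → Under k → ℕ → ℕ → Set
  FollowsFresh : ∀ {k} → Fresh k → ℕ → ℕ → Set

  FollowsFree done p = ⊤
  FollowsFree fix p = f p ≡ p
  FollowsFree (swap w) p = Arc p (1 + p) × FollowsFree w (2 + p)
  FollowsFree (opening w) p = f (1 + p) ≡ 1 + p × FollowsUnder w (2 + p) p

  FollowsUnder (swap w) p o = Arc p (1 + p) × FollowsUnder w (2 + p) o
  FollowsUnder (close w) p o = f p ≡ p × Arc o (1 + p) × FollowsFree w (2 + p)
  FollowsUnder (cross w) p o = Arc o (1 + p) × FollowsFresh w (2 + p) p

  FollowsFresh fin p o = Arc o p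
  FollowsFresh (cont w) p o = FollowsUnder w p o

  Follows : ∀ {b n} → Start b n → Set
  Follows (plain w) = FollowsFree w 0
  Follows (fixed w) = f 0 ≡ 0 × FollowsFree w 1
  Follows (linked w) = FollowsUnder (cross w) 1 0

≤-split : ∀ {p i} → p ≤ i → i ≡ p ⊎ i ≡ 1 + p ⊎ 2 + p ≤ i
≤-split p≤i with m≤n⇒m<n∨m≡n p≤i
... | inj₂ refl = inj₁ refl
... | inj₁ p<i with m≤n⇒m<n∨m≡n p<i
...   | inj₂ refl = inj₂ (inj₁ refl)
...   | inj₁ q<i = inj₂ (inj₂ q<i)

-- The function described by a word

closerUnder : ∀ {k} → Under k → ℕ → ℕ
closerFresh : ∀ {k} → Fresh k → ℕ → ℕ
closerUnder (swap w) p = closerUnder w (2 + p)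
closerUnder (close w) p = 1 + p
closerUnder (cross w) p = 1 + p
closerFresh fin p = p
closerFresh (cont w) p = closerUnder w p

valueFree : ∀ {k} → Free k → ℕ → ℕ → ℕ
valueUnder : ∀ {k} → Under k → ℕ → ℕ → ℕ → ℕ
valueFresh : ∀ {k} → Fresh k → ℕ → ℕ → ℕ → ℕ

-- Offsets past the end of a word get arbitrary values; only those below its length are ever
-- compared.
valueFree done p j = 0
valueFree fix p j = p
valueFree (swap w) p 0 = 1 + p
valueFree (swap w) p 1 = p
valueFree (swap w) p (suc (suc j)) = valueFree w (2 + p) j
valueFree (opening w) p 0 = closerUnder w (2 + p)
valueFree (opening w) p 1 = 1 + p
valueFree (opening w) p (suc (suc j)) = valueUnder w (2 + p) p j

valueUnder (swap w) p o 0 = 1 + p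
valueUnder (swap w) p o 1 = p
valueUnder (swap w) p o (suc (suc j)) = valueUnder w (2 + p) o j
valueUnder (close w) p o 0 = p
valueUnder (close w) p o 1 = o
valueUnder (close w) p o (suc (suc j)) = valueFree w (2 + p) j
valueUnder (cross w) p o 0 = closerFresh w (2 + p)
valueUnder (cross w) p o 1 = o
valueUnder (cross w) p o (suc (suc j)) = valueFresh w (2 + p) p j

valueFresh fin p o j = o
valueFresh (cont w) p o j = valueUnder w p o j

value : ∀ {b n} → Start b n → ℕ → ℕ
value (plain w) j = valueFree w 0 j
value (fixed w) 0 = 0
value (fixed w) (suc j) = valueFree w 1 j
value (linked w) 0 = 2
value (linked w) (suc j) = valueUnder (cross w) 1 0 j

module _ {f : ℕ → ℕ} where
  shift² : ∀ {k p} {g : ℕ → ℕ} → (∀ j → j < 2 + k → f (j + p) ≡ g j) →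
    ∀ j → j < k → f (j + (2 + p)) ≡ g (2 + j)
  shift² {p = p} h j l =
    trans (cong f (trans (+-suc j (1 + p)) (cong suc (+-suc j p)))) (h (2 + j) (s≤s (s≤s l)))

  private
    0<2+ : ∀ {k} → 0 < 2 + k
    0<2+ = s≤s z≤n

    1<2+ : ∀ {k} → 1 < 2 + k
    1<2+ = s≤s (s≤s z≤n)

  -- Any function with the right values on these positions will do, since a permutation rebuilt from
  -- a word agrees with `value` only below n. The left end of an open arc lies before them, so its
  -- value is a separate hypothesis.
  valueFree-follows : ∀ {k} (w : Free k) p →
    (∀ j → j < k → f (j + p) ≡ valueFree w p j) → FollowsFree f w p
  valueUnder-follows : ∀ {k} (w : Under k) p o → f o ≡ closerUnder w p →
    (∀ j → j < k → f (j + p) ≡ valueUnder w p o j) → FollowsUnder f w p o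
  valueFresh-follows : ∀ {k} (w : Fresh k) p o → f o ≡ closerFresh w p →
    (∀ j → j < k → f (j + p) ≡ valueFresh w p o j) → FollowsFresh f w p o

  valueFree-follows done p h = tt
  valueFree-follows fix p h = h 0 ≤-refl
  valueFree-follows (swap w) p h =
    (h 0 0<2+ , h 1 1<2+) , valueFree-follows w (2 + p) (shift² h)
  valueFree-follows (opening w) p h =
    h 1 1<2+ , valueUnder-follows w (2 + p) p (h 0 0<2+) (shift² h)

  valueUnder-follows (swap w) p o c h =
    (h 0 0<2+ , h 1 1<2+) , valueUnder-follows w (2 + p) o c (shift² h)
  valueUnder-follows (close w) p o c h =
    h 0 0<2+ , (c , h 1 1<2+) , valueFree-follows w (2 + p) (shift² h)
  valueUnder-follows (cross w) p o c h =
    (c , h 1 1<2+) , valueFresh-follows w (2 + p) p (h 0 0<2+) (shift² h)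

  valueFresh-follows fin p o c h = c , h 0 ≤-refl
  valueFresh-follows (cont w) p o c h = valueUnder-follows w p o c h

  value-follows : ∀ {b n} (w : Start b n) → (∀ j → j < n → f j ≡ value w j) → Follows f w
  value-follows (plain w) h =
    valueFree-follows w 0 λ j l → trans (cong f (+-identityʳ j)) (h j l)
  value-follows (fixed w) h = h 0 (s≤s z≤n) ,
    valueFree-follows w 1 λ j l → trans (cong f (+-comm j 1)) (h (suc j) (s≤s l))
  value-follows (linked w) h =
    valueUnder-follows (cross w) 1 0 (h 0 (s≤s z≤n)) λ j l →
      trans (cong f (+-comm j 1)) (h (suc j) (s≤s l))

module _ {f : ℕ → ℕ} where
  -- Strict, because such an arc always ends at the second position of a pair; a `Fresh` arc may end
  -- at `p` itself, through `fin`.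
  closer-under : ∀ {k} (w : Under k) p o → FollowsUnder f w p o → p < f o
  closer-fresh : ∀ {k} (w : Fresh k) p o → FollowsFresh f w p o → p ≤ f o
  closer-under (swap w) p o (_ , r) = ≤-trans (n≤1+n _) (<⇒≤ (closer-under w (2 + p) o r))
  closer-under (close w) p o (_ , (c , _) , _) = ≤-reflexive (sym c)
  closer-under (cross w) p o ((c , _) , _) = ≤-reflexive (sym c)
  closer-fresh fin p o (c , _) = ≤-reflexive (sym c)
  closer-fresh (cont w) p o r = <⇒≤ (closer-under w p o r)

-- A function determines its word

module _ {f g : ℕ → ℕ} (f≗g : ∀ i → f i ≡ g i) where
  clash : ∀ {i x y} → f i ≡ x → g i ≡ y → x ≡ y
  clash fi gi = trans (sym fi) (trans (f≗g _) gi)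

  -- The values at `p` and `1 + p` reveal the first constructor. Under an arc, `f p` is `1 + p`, `p`
  -- or at least `2 + p` for `swap`, `close` or `cross`. Two functions appear because permutations
  -- are compared only pointwise.
  uniqueFree : ∀ {k} (v w : Free k) p → FollowsFree f v p → FollowsFree g w p → v ≡ w
  uniqueUnder : ∀ {k} (v w : Under k) p o → o < p →
    FollowsUnder f v p o → FollowsUnder g w p o → v ≡ w
  uniqueFresh : ∀ {k} (v w : Fresh k) p o → o < p →
    FollowsFresh f v p o → FollowsFresh g w p o → v ≡ w

  uniqueFree done done p _ _ = refl
  uniqueFree fix fix p _ _ = refl
  uniqueFree (swap v) (swap w) p (_ , r) (_ , s) = cong swap (uniqueFree v w _ r s)
  uniqueFree (swap v) (opening w) p ((_ , a) , _) (b , _) = contradiction (sym (clash a b)) 1+n≢n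
  uniqueFree (opening v) (swap w) p (a , _) ((_ , b) , _) = contradiction (clash a b) 1+n≢n
  uniqueFree (opening v) (opening w) p (_ , r) (_ , s) =
    cong opening (uniqueUnder v w _ _ (m<n⇒m<1+n (n<1+n p)) r s)

  uniqueUnder (swap v) (swap w) p o l (_ , r) (_ , s) =
    cong swap (uniqueUnder v w _ _ (m<n⇒m<1+n (m<n⇒m<1+n l)) r s)
  uniqueUnder (swap v) (close w) p o l ((a , _) , _) (b , _) = contradiction (clash a b) 1+n≢n
  uniqueUnder (swap v) (cross w) p o l ((_ , a) , _) ((_ , b) , _) =
    contradiction (sym (clash a b)) (<⇒≢ l)
  uniqueUnder (close v) (swap w) p o l (a , _) ((b , _) , _) = contradiction (sym (clash a b)) 1+n≢n
  uniqueUnder (close v) (close w) p o l (_ , _ , r) (_ , _ , s) = cong close (uniqueFree v w _ r s)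
  uniqueUnder (close v) (cross w) p o l (a , _) (_ , s) =
    contradiction (clash a refl) (<⇒≢ (≤-trans (n≤1+n _) (closer-fresh w _ _ s)))
  uniqueUnder (cross v) (swap w) p o l ((_ , a) , _) ((_ , b) , _) =
    contradiction (clash a b) (<⇒≢ l)
  uniqueUnder (cross v) (close w) p o l (_ , r) (b , _) =
    contradiction (sym (clash refl b)) (<⇒≢ (≤-trans (n≤1+n _) (closer-fresh v _ _ r)))
  uniqueUnder (cross v) (cross w) p o l (_ , r) (_ , s) =
    cong cross (uniqueFresh v w _ _ (m<n⇒m<1+n (n<1+n p)) r s)

  uniqueFresh fin fin p o l r s = refl
  uniqueFresh fin (cont ()) p o l r s
  uniqueFresh (cont ()) fin p o l r s
  uniqueFresh (cont v) (cont w) p o l r s = cong cont (uniqueUnder v w p o l r s)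

  unique : ∀ {b n} (v w : Start b n) → Follows f v → Follows g w → v ≡ w
  unique (plain v) (plain w) r s = cong plain (uniqueFree v w 0 r s)
  unique (fixed v) (fixed w) (_ , r) (_ , s) = cong fixed (uniqueFree v w 1 r s)
  unique (fixed v) (linked w) (a , _) ((b , _) , _) = contradiction (clash a b) λ ()
  unique (linked v) (fixed w) ((a , _) , _) (b , _) = contradiction (clash a b) λ ()
  unique (linked v) (linked w) (_ , r) (_ , s) =
    cong linked (uniqueFresh v w 3 1 (s≤s (s≤s z≤n)) r s)

-- A word determines its function

step² : ∀ k {p n} → (2 + k) + p ≡ n → k + (2 + p) ≡ n
step² k {p} e = trans (trans (+-suc k (1 + p)) (cong suc (+-suc k p))) e

module _ {f g : ℕ → ℕ} {n : ℕ} where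
  private
    AgreeFrom : ℕ → Set
    AgreeFrom p = ∀ i → p ≤ i → i < n → f i ≡ g i

    meet : ∀ {i j x} → f i ≡ x → g j ≡ x → f i ≡ g j
    meet a b = trans a (sym b)

    extend : ∀ {p} → f p ≡ g p → f (1 + p) ≡ g (1 + p) → AgreeFrom (2 + p) → AgreeFrom p
    extend a b h i p≤i i<n with ≤-split p≤i
    ... | inj₁ refl = a
    ... | inj₂ (inj₁ refl) = b
    ... | inj₂ (inj₂ q<i) = h i q<i i<n

  agreeFree : ∀ {k} (w : Free k) p → k + p ≡ n → FollowsFree f w p → FollowsFree g w p → AgreeFrom p
  -- The value at `o` is settled only where its arc ends, so it is handed back to the pair that
  -- opened the arc.
  agreeUnder : ∀ {k} (w : Under k) p o → k + p ≡ n →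
    FollowsUnder f w p o → FollowsUnder g w p o → f o ≡ g o × AgreeFrom p
  agreeFresh : ∀ {k} (w : Fresh k) p o → k + p ≡ n →
    FollowsFresh f w p o → FollowsFresh g w p o → f o ≡ g o × AgreeFrom p

  agreeFree done p refl _ _ i p≤i i<n = contradiction i<n (≤⇒≯ p≤i)
  agreeFree fix p refl r s i p≤i i<n with ≤-antisym p≤i (≤-pred i<n)
  ... | refl = meet r s
  agreeFree {suc (suc k)} (swap w) p e ((a , a′) , r) ((b , b′) , s) =
    extend (meet a b) (meet a′ b′) (agreeFree w _ (step² k e) r s)
  agreeFree {suc (suc k)} (opening w) p e (a , r) (b , s) =
    let c , h = agreeUnder w _ _ (step² k e) r s in extend c (meet a b) h

  agreeUnder {suc (suc k)} (swap w) p o e ((a , a′) , r) ((b , b′) , s) =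
    let c , h = agreeUnder w _ _ (step² k e) r s in c , extend (meet a b) (meet a′ b′) h
  agreeUnder {suc (suc k)} (close w) p o e (a , (c , c′) , r) (b , (d , d′) , s) =
    meet c d , extend (meet a b) (meet c′ d′) (agreeFree w _ (step² k e) r s)
  agreeUnder {suc (suc k)} (cross w) p o e ((c , c′) , r) ((d , d′) , s) =
    let a , h = agreeFresh w _ _ (step² k e) r s in meet c d , extend a (meet c′ d′) h

  agreeFresh fin p o refl (a , a′) (b , b′) = meet a b , last
    where
    last : AgreeFrom p
    last i p≤i i<n with ≤-antisym p≤i (≤-pred i<n)
    ... | refl = meet a′ b′
  agreeFresh (cont w) p o e r s = agreeUnder w p o e r s

agree : ∀ {f g b n} (w : Start b n) → Follows f w → Follows g w → ∀ i → i < n → f i ≡ g i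
agree (plain w) r s i i<n = agreeFree w 0 (+-identityʳ _) r s i z≤n i<n
agree (fixed w) (a , r) (b , s) zero i<n = trans a (sym b)
agree (fixed w) (a , r) (b , s) (suc i) i<n = agreeFree w 1 (+-comm _ 1) r s (suc i) (s≤s z≤n) i<n
agree {n = suc (suc (suc k))} (linked w) r s zero i<n =
  proj₁ (agreeUnder (cross w) 1 0 (+-comm (2 + k) 1) r s)
agree {n = suc (suc (suc k))} (linked w) r s (suc i) i<n =
  proj₂ (agreeUnder (cross w) 1 0 (+-comm (2 + k) 1) r s) (suc i) (s≤s z≤n) i<n

-- Zigzag involutions avoiding 3421

peak : Bool → ℕ → Bool
peak b zero = b
peak b (suc i) = not (peak b i)

Avoids3421 Avoids4312 : (ℕ → ℕ) → ℕ → Set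
Avoids3421 f n = ∀ {a b c d} → a < b → b < c → c < d → d < n →
  f a < f b → f c < f a → f d < f c → ⊥
Avoids4312 f n = ∀ {a b c d} → a < b → b < c → c < d → d < n →
  f b < f a → f d < f b → f c < f d → ⊥

record Valid (b : Bool) (n : ℕ) (f : ℕ → ℕ) : Set where
  field
    bound   : ∀ {i} → i < n → f i < n
    invol   : ∀ {i} → i < n → f (f i) ≡ i
    descent : ∀ {i} → suc i < n → peak b i ≡ true → f (suc i) < f i
    ascent  : ∀ {i} → suc i < n → peak b i ≡ false → f i < f (suc i)
    avoids3421 : Avoids3421 f n

  injective : ∀ {i j} → i < n → j < n → f i ≡ f j → i ≡ j
  injective i<n j<n e = trans (sym (invol i<n)) (trans (cong f e) (invol j<n))

  -- Exchanging positions and values turns a 4312 at `a`, `b`, `c`, `d` into a 3421 at `f c`, `f d`,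
  -- `f b`, `f a`.
  avoids4312 : Avoids4312 f n
  avoids4312 a<b b<c c<d d<n fb<fa fd<fb fc<fd = avoids3421 fc<fd fd<fb fb<fa (bound a<n)
    (subst₂ _<_ (sym (invol c<n)) (sym (invol d<n)) c<d)
    (subst₂ _<_ (sym (invol b<n)) (sym (invol c<n)) b<c)
    (subst₂ _<_ (sym (invol a<n)) (sym (invol b<n)) a<b)
    where
    c<n = <-trans c<d d<n
    b<n = <-trans b<c c<n
    a<n = <-trans a<b b<n

k+p≡n⇒p≤n : ∀ k {p n} → k + p ≡ n → p ≤ n
k+p≡n⇒p≤n k {p} refl = m≤n+m p k

-- Every word gives a zigzag involution avoiding 3421

module Structure (f : ℕ → ℕ) (n : ℕ) where
  -- One recursion over the word thus yields the bound, involutivity and the control over arcs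
  -- crossing a gap.
  Matched : ℕ → ℕ → Set
  Matched p i = p ≤ f i × f i < n × f (f i) ≡ i

  MatchedFrom : ℕ → Set
  MatchedFrom p = ∀ {i} → p ≤ i → i < n → Matched p i

  MatchedFromBut : ℕ → ℕ → Set
  MatchedFromBut o p = ∀ {i} → p ≤ i → i < n → Matched p i ⊎ Arc f o i

  weaken : ∀ {p i} → Matched (2 + p) i → Matched p i
  weaken (l , r) = ≤-trans (m≤n+m _ 2) l , r

  fixed-matched : ∀ {p i} → p ≤ i → i < n → f i ≡ i → Matched p i
  fixed-matched p≤i i<n e rewrite e = p≤i , i<n , e

  arc-matchedˡ : ∀ {p i j} → p ≤ j → j < n → Arc f i j → Matched p i
  arc-matchedˡ p≤j j<n (a , b) rewrite a = p≤j , j<n , b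

  arc-matchedʳ : ∀ {p i j} → p ≤ i → i < n → Arc f i j → Matched p j
  arc-matchedʳ p≤i i<n (a , b) = arc-matchedˡ p≤i i<n (b , a)

  matchedFree : ∀ {k} (w : Free k) p → k + p ≡ n → FollowsFree f w p → MatchedFrom p
  matchedUnder : ∀ {k} (w : Under k) p o → k + p ≡ n → FollowsUnder f w p o →
    Matched p o × MatchedFromBut o p
  matchedFresh : ∀ {k} (w : Fresh k) p o → k + p ≡ n → FollowsFresh f w p o →
    Matched p o × MatchedFromBut o p

  matchedFree done p refl _ p≤i i<n = contradiction i<n (≤⇒≯ p≤i)
  matchedFree fix p refl r p≤i i<n with ≤-antisym p≤i (≤-pred i<n)
  ... | refl = fixed-matched ≤-refl i<n r
  matchedFree {suc (suc k)} (swap w) p e (a , r) p≤i i<n with ≤-split p≤i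
  ... | inj₁ refl = arc-matchedˡ (n≤1+n p) (k+p≡n⇒p≤n k (step² k e)) a
  ... | inj₂ (inj₁ refl) = arc-matchedʳ ≤-refl (<⇒≤ i<n) a
  ... | inj₂ (inj₂ q<i) = weaken (matchedFree w _ (step² k e) r q<i i<n)
  matchedFree {suc (suc k)} (opening w) p e (a , r) p≤i i<n with ≤-split p≤i
  ... | inj₁ refl = weaken (proj₁ (matchedUnder w _ _ (step² k e) r))
  ... | inj₂ (inj₁ refl) = fixed-matched p≤i i<n a
  ... | inj₂ (inj₂ q<i) with proj₂ (matchedUnder w _ _ (step² k e) r) q<i i<n
  ...   | inj₁ m = weaken m
  ...   | inj₂ c = arc-matchedʳ ≤-refl (<-≤-trans (m<n+m p (s≤s z≤n)) (<⇒≤ (≤-<-trans q<i i<n))) c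

  matchedUnder {suc (suc k)} (swap w) p o e (a , r) = weaken (proj₁ rest) , from
    where
    rest = matchedUnder w _ _ (step² k e) r
    from : MatchedFromBut o p
    from p≤i i<n with ≤-split p≤i
    ... | inj₁ refl = inj₁ (arc-matchedˡ (n≤1+n p) (k+p≡n⇒p≤n k (step² k e)) a)
    ... | inj₂ (inj₁ refl) = inj₁ (arc-matchedʳ ≤-refl (<⇒≤ i<n) a)
    ... | inj₂ (inj₂ q<i) with proj₂ rest q<i i<n
    ...   | inj₁ m = inj₁ (weaken m)
    ...   | inj₂ c = inj₂ c
  matchedUnder {suc (suc k)} (close w) p o e (a , c , r) =
    arc-matchedˡ (n≤1+n p) (k+p≡n⇒p≤n k (step² k e)) c , from
    where
    from : MatchedFromBut o p
    from p≤i i<n with ≤-split p≤i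
    ... | inj₁ refl = inj₁ (fixed-matched p≤i i<n a)
    ... | inj₂ (inj₁ refl) = inj₂ c
    ... | inj₂ (inj₂ q<i) = inj₁ (weaken (matchedFree w _ (step² k e) r q<i i<n))
  matchedUnder {suc (suc k)} (cross w) p o e (c , r) =
    arc-matchedˡ (n≤1+n p) (k+p≡n⇒p≤n k (step² k e)) c , from
    where
    rest = matchedFresh w _ _ (step² k e) r
    from : MatchedFromBut o p
    from p≤i i<n with ≤-split p≤i
    ... | inj₁ refl = inj₁ (weaken (proj₁ rest))
    ... | inj₂ (inj₁ refl) = inj₂ c
    ... | inj₂ (inj₂ q<i) with proj₂ rest q<i i<n
    ...   | inj₁ m = inj₁ (weaken m)
    ...   | inj₂ d = inj₁ (arc-matchedʳ ≤-refl (<-trans (n<1+n p) (≤-<-trans (<⇒≤ q<i) i<n)) d)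

  matchedFresh fin p o refl c = arc-matchedˡ ≤-refl ≤-refl c , from
    where
    from : MatchedFromBut o p
    from p≤i i<n with ≤-antisym p≤i (≤-pred i<n)
    ... | refl = inj₂ c
  matchedFresh (cont w) p o e r = matchedUnder w p o e r

  -- At most one arc passes over the gap in front of `p`; each such arc is represented by its right
  -- end.
  Cut : ℕ → Set
  Cut p = ∀ {i j} → p ≤ i → i < n → p ≤ j → j < n → f i < p → f j < p → i ≡ j

  cut-free : ∀ {p} → MatchedFrom p → Cut p
  cut-free m p≤i i<n _ _ fi<p _ = contradiction fi<p (≤⇒≯ (proj₁ (m p≤i i<n)))

  cut-but : ∀ {o p} → MatchedFromBut o p → Cut p
  cut-but m p≤i i<n p≤j j<n fi<p fj<p with m p≤i i<n | m p≤j j<n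
  ... | inj₁ (l , _) | _ = contradiction fi<p (≤⇒≯ l)
  ... | inj₂ _ | inj₁ (l , _) = contradiction fj<p (≤⇒≯ l)
  ... | inj₂ (a , _) | inj₂ (b , _) = trans (sym a) b

  -- These local facts replace the word: avoidance and the zigzag shape are derived from them
  -- without further recursion.
  record Pair (p : ℕ) : Set where
    field
      inside    : 1 + p < n
      cutBefore : Cut p
      cutAfter  : Cut (2 + p)
      low       : f (1 + p) ≤ 1 + p
      down      : f (1 + p) < f p
      up        : 2 + p < n → f (1 + p) < f (2 + p)

  module Views (top : ℕ → Bool) (alternates : ∀ i → top (suc i) ≡ not (top i)) where
    data View : ℕ → Set where
      first  : ∀ {p} → top p ≡ true → Pair p → View p
      second : ∀ {p} → top (1 + p) ≡ false → Pair p → View (1 + p)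
      last   : ∀ {p} → top p ≡ true → 1 + p ≡ n → Cut p → View p

    ViewFrom : ℕ → Set
    ViewFrom p = ∀ {i} → p ≤ i → i < n → View i

    extend : ∀ {p} → top p ≡ true → Pair p → ViewFrom (2 + p) → ViewFrom p
    extend t P v p≤i i<n with ≤-split p≤i
    ... | inj₁ refl = first t P
    ... | inj₂ (inj₁ refl) = second (trans (alternates _) (cong not t)) P
    ... | inj₂ (inj₂ q<i) = v q<i i<n

    top² : ∀ {p} → top p ≡ true → top (2 + p) ≡ true
    top² {p} t = trans (alternates (1 + p)) (cong not (trans (alternates p) (cong not t)))

    headFree : ∀ {k} (w : Free k) p → k + p ≡ n → FollowsFree f w p → p < n → p ≤ f p
    headFree w p e r p<n = proj₁ (matchedFree w p e r ≤-refl p<n)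

    headUnder : ∀ {k} (w : Under k) p o → FollowsUnder f w p o → p ≤ f p
    headUnder (swap w) p o ((a , _) , _) = ≤-trans (n≤1+n p) (≤-reflexive (sym a))
    headUnder (close w) p o (a , _) = ≤-reflexive (sym a)
    headUnder (cross w) p o (_ , r) = ≤-trans (m≤n+m p 2) (closer-fresh w _ _ r)

    -- Only `o` bounds the value from below, as `fin` attains it. This suffices for the ascent after
    -- a crossing, whose smaller entry is an even earlier left end.
    headFresh : ∀ {k} (w : Fresh k) p o → o < p → FollowsFresh f w p o → o ≤ f p
    headFresh fin p o l (_ , a) = ≤-reflexive (sym a)
    headFresh (cont w) p o l r = <⇒≤ (<-≤-trans l (headUnder w p o r))

    viewFree : ∀ {k} (w : Free k) p → top p ≡ true → k + p ≡ n → FollowsFree f w p → ViewFrom p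
    viewUnder : ∀ {k} (w : Under k) p o → o < p → top p ≡ true → k + p ≡ n →
      FollowsUnder f w p o → ViewFrom p
    viewFresh : ∀ {k} (w : Fresh k) p o → o < p → top p ≡ true → k + p ≡ n →
      FollowsFresh f w p o → ViewFrom p

    viewFree done p t refl r p≤i i<n = contradiction i<n (≤⇒≯ p≤i)
    viewFree fix p t refl r p≤i i<n with ≤-antisym p≤i (≤-pred i<n)
    ... | refl = last t refl (cut-free (matchedFree fix p refl r))
    viewFree {suc (suc k)} W@(swap w) p t e R@((a , a′) , r) = extend t
      (record
        { inside = k+p≡n⇒p≤n k e′
        ; cutBefore = cut-free (matchedFree W p e R)
        ; cutAfter = cut-free (matchedFree w _ e′ r)
        ; low = ≤-trans (≤-reflexive a′) (n≤1+n p)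
        ; down = subst₂ _<_ (sym a′) (sym a) ≤-refl
        ; up = λ l → ≤-<-trans (≤-reflexive a′) (≤-trans (n≤1+n _) (headFree w _ e′ r l)) })
      (viewFree w _ (top² t) e′ r)
      where e′ = step² k e
    viewFree {suc (suc k)} W@(opening w) p t e R@(a , r) = extend t
      (record
        { inside = k+p≡n⇒p≤n k e′
        ; cutBefore = cut-free (matchedFree W p e R)
        ; cutAfter = cut-but (proj₂ (matchedUnder w _ _ e′ r))
        ; low = ≤-reflexive a
        ; down = ≤-<-trans (≤-reflexive a) (≤-trans (n≤1+n _) (closer-under w _ _ r))
        ; up = λ l → ≤-<-trans (≤-reflexive a) (headUnder w _ _ r) })
      (viewUnder w _ _ (m<n⇒m<1+n ≤-refl) (top² t) e′ r)
      where e′ = step² k e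

    viewUnder {suc (suc k)} W@(swap w) p o o<p t e R@((a , a′) , r) = extend t
      (record
        { inside = k+p≡n⇒p≤n k e′
        ; cutBefore = cut-but (proj₂ (matchedUnder W p o e R))
        ; cutAfter = cut-but (proj₂ (matchedUnder w _ _ e′ r))
        ; low = ≤-trans (≤-reflexive a′) (n≤1+n p)
        ; down = subst₂ _<_ (sym a′) (sym a) ≤-refl
        ; up = λ l → ≤-<-trans (≤-reflexive a′) (≤-trans (n≤1+n _) (headUnder w _ _ r)) })
      (viewUnder w _ _ (m<n⇒m<1+n (m<n⇒m<1+n o<p)) (top² t) e′ r)
      where e′ = step² k e
    viewUnder {suc (suc k)} W@(close w) p o o<p t e R@(a , (c , c′) , r) = extend t
      (record
        { inside = k+p≡n⇒p≤n k e′
        ; cutBefore = cut-but (proj₂ (matchedUnder W p o e R))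
        ; cutAfter = cut-free (matchedFree w _ e′ r)
        ; low = ≤-trans (≤-reflexive c′) (≤-trans (<⇒≤ o<p) (n≤1+n p))
        ; down = subst₂ _<_ (sym c′) (sym a) o<p
        ; up = λ l → ≤-<-trans (≤-reflexive c′) (<-≤-trans (m<n⇒m<1+n (m<n⇒m<1+n o<p)) (headFree w _ e′ r l)) })
      (viewFree w _ (top² t) e′ r)
      where e′ = step² k e
    viewUnder {suc (suc k)} W@(cross w) p o o<p t e R@((c , c′) , r) = extend t
      (record
        { inside = k+p≡n⇒p≤n k e′
        ; cutBefore = cut-but (proj₂ (matchedUnder W p o e R))
        ; cutAfter = cut-but (proj₂ (matchedFresh w _ _ e′ r))
        ; low = ≤-trans (≤-reflexive c′) (≤-trans (<⇒≤ o<p) (n≤1+n p))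
        ; down = ≤-<-trans (≤-reflexive c′)
            (<-≤-trans (m<n⇒m<1+n (m<n⇒m<1+n o<p)) (closer-fresh w _ _ r))
        ; up = λ l → ≤-<-trans (≤-reflexive c′)
            (<-≤-trans o<p (headFresh w _ _ (m<n⇒m<1+n ≤-refl) r)) })
      (viewFresh w _ _ (m<n⇒m<1+n ≤-refl) (top² t) e′ r)
      where e′ = step² k e

    viewFresh fin p o o<p t refl r p≤i i<n with ≤-antisym p≤i (≤-pred i<n)
    ... | refl = last t refl (cut-but (proj₂ (matchedFresh fin p o refl r)))
    viewFresh (cont w) p o o<p t e r = viewUnder w p o o<p t e r

    module _ (bound : ∀ {i} → i < n → f i < n) (invol : ∀ {i} → i < n → f (f i) ≡ i)
             (view : ViewFrom 1) where
      back : ∀ {i x} → i < n → i < x → f (f i) < x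
      back i<n = ≤-<-trans (≤-reflexive (invol i<n))

      -- If `f b ≤ b`, the arcs of `c` and `d` share a gap at or just before `c`. Otherwise `b` is
      -- the first position of a pair, and two of the four arcs share the gap before or after that
      -- pair. Only `b` and `c` are viewed, and neither can be position 0.
      views⇒avoids3421 : Avoids3421 f n
      views⇒avoids3421 {a} {b} {c} {d} a<b b<c c<d d<n fa<fb fc<fa fd<fc with f b ≤? b
      ... | yes fb≤b = atC (view (≤-<-trans z≤n b<c) c<n)
        where
        c<n = <-trans c<d d<n
        fc+2≤b : 2 + f c ≤ b
        fc+2≤b = ≤-trans (≤-trans (s≤s fc<fa) fa<fb) fb≤b
        fc<c : f c < c
        fc<c = <-trans (m<n+m _ (s≤s z≤n)) (≤-<-trans fc+2≤b b<c)
        clash-at : ∀ {g} → Cut g → g ≤ c → f c < g → ⊥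
        clash-at cut g≤c fc<g =
          <⇒≢ c<d (cut g≤c c<n (≤-trans g≤c (<⇒≤ c<d)) d<n fc<g (<-trans fd<fc fc<g))
        atC : View c → ⊥
        atC (first _ P) = clash-at (Pair.cutBefore P) ≤-refl fc<c
        atC (last _ _ cut) = clash-at cut ≤-refl fc<c
        -- The gap now lies one position before `c`; since `f c < b` and `b < c`, the arc still
        -- passes over it.
        atC (second _ P) = clash-at (Pair.cutBefore P) (n≤1+n _)
          (≤-trans (n≤1+n _) (≤-trans fc+2≤b (≤-pred b<c)))
      ... | no fb≰b = atB (view (≤-<-trans z≤n a<b) b<n)
        where
        c<n = <-trans c<d d<n
        b<n = <-trans b<c c<n
        a<n = <-trans a<b b<n
        b<fb = ≰⇒> fb≰b
        atB : View b → ⊥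
        atB (second _ P) = fb≰b (Pair.low P)
        atB (last _ refl _) = <⇒≱ (bound b<n) b<fb
        atB (first _ P) with f c <? b
        ... | yes fc<b = <⇒≢ c<d
          (Pair.cutBefore P (<⇒≤ b<c) c<n (<⇒≤ (<-trans b<c c<d)) d<n fc<b (<-trans fd<fc fc<b))
        ... | no fc≮b with m≤n⇒m<n∨m≡n (≤-<-trans (≮⇒≥ fc≮b) fc<fa)
        ...   | inj₁ q<fa = <⇒≢ fa<fb
          (Pair.cutAfter P q<fa (bound a<n) (<-trans q<fa fa<fb) (bound b<n)
            (back a<n (m<n⇒m<1+n (m<n⇒m<1+n a<b))) (back b<n (m<n⇒m<1+n ≤-refl)))
        -- Here `f a` is `1 + b`, so the arcs of `a` and `d` both pass over the gap before `b`.
        -- Hence `d` is `1 + b` as well, which leaves no room for `c`.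
        ...   | inj₂ q≡fa = <⇒≱ (<-≤-trans b<c (≤-pred (subst (c <_) d≡q c<d))) ≤-refl
          where
          fc≤b : f c ≤ b
          fc≤b = ≤-pred (subst (f c <_) (sym q≡fa) fc<fa)
          d≡q : d ≡ 1 + b
          d≡q = trans (Pair.cutBefore P (<⇒≤ (<-trans b<c c<d)) d<n (≤-trans (n≤1+n b) (≤-reflexive q≡fa))
            (bound a<n) (<-≤-trans fd<fc fc≤b) (back a<n a<b)) (sym q≡fa)

      views⇒descent : ∀ {i} → 1 ≤ i → suc i < n → top i ≡ true → f (suc i) < f i
      views⇒descent 1≤i si<n t with view 1≤i (<-trans (n<1+n _) si<n)
      ... | first _ P = Pair.down P
      ... | second t′ P = case trans (sym t) t′ of λ ()
      ... | last _ refl _ = contradiction si<n (n≮n _)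

      views⇒ascent : ∀ {i} → 1 ≤ i → suc i < n → top i ≡ false → f i < f (suc i)
      views⇒ascent 1≤i si<n t with view 1≤i (<-trans (n<1+n _) si<n)
      ... | first t′ P = case trans (sym t) t′ of λ ()
      ... | second _ P = Pair.up P si<n
      ... | last t′ _ _ = case trans (sym t) t′ of λ ()

-- The views from position 1 on settle everything but the bound, involutivity and the comparison of
-- positions 0 and 1, which depend on the kind of start.
follows⇒valid : ∀ {b n f} (w : Start b n) → Follows f w → Valid b n f
follows⇒valid {n = n} {f} (plain w) r = record
  { bound = bound ; invol = invol
  ; descent = λ { {zero} l _ → desc₀ l ; {suc i} → views⇒descent bound invol view (s≤s z≤n) }
  ; ascent = λ { {zero} _ () ; {suc i} → views⇒ascent bound invol view (s≤s z≤n) }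
  ; avoids3421 = views⇒avoids3421 bound invol view }
  where
  open Structure f n
  open Views (peak true) (λ _ → refl)
  matched : MatchedFrom 0
  matched = matchedFree w 0 (+-identityʳ n) r
  bound : ∀ {i} → i < n → f i < n
  bound l = proj₁ (proj₂ (matched z≤n l))
  invol : ∀ {i} → i < n → f (f i) ≡ i
  invol l = proj₂ (proj₂ (matched z≤n l))
  view₀ : ViewFrom 0
  view₀ = viewFree w 0 refl (+-identityʳ n) r
  view : ViewFrom 1
  view _ = view₀ z≤n
  desc₀ : 1 < n → f 1 < f 0
  desc₀ l with view₀ z≤n (<⇒≤ l)
  ... | first _ P = Pair.down P
  ... | last _ refl _ = contradiction l (n≮n 1)
follows⇒valid {n = suc k} {f} (fixed w) (f0≡0 , r) = record
  { bound = bound ; invol = invol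
  ; descent = λ { {zero} _ () ; {suc i} → views⇒descent bound invol view (s≤s z≤n) }
  ; ascent = λ { {zero} l _ → ≤-<-trans (≤-reflexive f0≡0) (proj₁ (matched ≤-refl l))
               ; {suc i} → views⇒ascent bound invol view (s≤s z≤n) }
  ; avoids3421 = views⇒avoids3421 bound invol view }
  where
  open Structure f (suc k)
  open Views (peak false) (λ _ → refl)
  matched : MatchedFrom 1
  matched = matchedFree w 1 (+-comm k 1) r
  bound : ∀ {i} → i < suc k → f i < suc k
  bound {zero} l = ≤-<-trans (≤-reflexive f0≡0) l
  bound {suc i} l = proj₁ (proj₂ (matched (s≤s z≤n) l))
  invol : ∀ {i} → i < suc k → f (f i) ≡ i
  invol {zero} l = trans (cong f f0≡0) f0≡0
  invol {suc i} l = proj₂ (proj₂ (matched (s≤s z≤n) l))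
  view : ViewFrom 1
  view = viewFree w 1 refl (+-comm k 1) r
follows⇒valid {n = suc (suc (suc k))} {f} (linked w) r@((f0≡2 , f2≡0) , s) = record
  { bound = bound ; invol = invol
  ; descent = λ { {zero} _ () ; {suc i} → views⇒descent bound invol view (s≤s z≤n) }
  ; ascent = λ { {zero} l _ → ≤-<-trans (≤-reflexive f0≡2) (closer-fresh w 3 1 s)
               ; {suc i} → views⇒ascent bound invol view (s≤s z≤n) }
  ; avoids3421 = views⇒avoids3421 bound invol view }
  where
  n = 3 + k
  open Structure f n
  open Views (peak false) (λ _ → refl)
  matched : Matched 1 0 × MatchedFromBut 0 1
  matched = matchedUnder (cross w) 1 0 (+-comm (2 + k) 1) r
  bound : ∀ {i} → i < n → f i < n
  bound {zero} l = proj₁ (proj₂ (proj₁ matched))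
  bound {suc i} l with proj₂ matched (s≤s z≤n) l
  ... | inj₁ m = proj₁ (proj₂ m)
  ... | inj₂ (_ , e) = ≤-<-trans (≤-reflexive e) (s≤s z≤n)
  invol : ∀ {i} → i < n → f (f i) ≡ i
  invol {zero} l = proj₂ (proj₂ (proj₁ matched))
  invol {suc i} l with proj₂ matched (s≤s z≤n) l
  ... | inj₁ m = proj₂ (proj₂ m)
  ... | inj₂ (e , e′) = trans (cong f e′) e
  view : ViewFrom 1
  view = viewUnder (cross w) 1 0 ≤-refl refl (+-comm (2 + k) 1) r

-- Reading off the word

module Parse {b n f} (valid : Valid b n f) where
  open Valid valid

  -- The invariant of the parser: no arc passes over the gap before `p`, or, for `LowBut o p`, none
  -- except possibly the one from `o`.
  Low : ℕ → Set
  Low p = ∀ {i} → i < p → f i < p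

  LowBut : ℕ → ℕ → Set
  LowBut o p = ∀ {i} → i < p → i ≢ o → f i < p

  flat : ∀ {i j} → i < n → f i ≡ j → f j ≡ i
  flat i<n refl = invol i<n

  notSucc : ∀ {p} → peak b p ≡ true → peak b (suc p) ≡ false
  notSucc = cong not

  top² : ∀ {p} → peak b p ≡ true → peak b (2 + p) ≡ true
  top² t = cong (not ∘ not) t

  high : ∀ {p} → Low p → ∀ {i} → p ≤ i → i < n → p ≤ f i
  high low p≤i i<n = ≮⇒≥ λ fi<p → <⇒≱ (≤-<-trans (≤-reflexive (sym (invol i<n))) (low fi<p)) p≤i

  highBut : ∀ {o p} → LowBut o p → ∀ {i} → p ≤ i → i < n → f i ≢ o → p ≤ f i
  highBut low p≤i i<n fi≢o =
    ≮⇒≥ λ fi<p → <⇒≱ (≤-<-trans (≤-reflexive (sym (invol i<n))) (low fi<p fi≢o)) p≤i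

  low-swap : ∀ {p} → p < n → f p ≡ 1 + p → Low p → Low (2 + p)
  low-swap p<n e low {i} i<q with i <? _
  ... | yes i<p = m<n⇒m<1+n (m<n⇒m<1+n (low i<p))
  ... | no i≮p with ≤-split (≮⇒≥ i≮p)
  ...   | inj₁ refl = ≤-reflexive (cong suc e)
  ...   | inj₂ (inj₁ refl) = ≤-<-trans (≤-reflexive (flat p<n e)) (m<n⇒m<1+n ≤-refl)
  ...   | inj₂ (inj₂ q≤i) = contradiction i<q (≤⇒≯ q≤i)

  -- The value at 2 + p is even larger than that at 1 + p, and the positions
  -- f (1 + p) < f p then complete a 3421.
  no-double-excedance : ∀ {p} → peak b p ≡ true → suc p < n → 1 + p < f (suc p) → ⊥
  no-double-excedance {p} t q<n q<fq = avoids3421 {a = 1 + p} {b = 2 + p} {c = d} {d = e}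
    ≤-refl p′<d d<e e<n
    fq<fp′ (≤-<-trans (≤-reflexive (flat q<n refl)) q<fq)
    (subst₂ _<_ (sym (flat p<n refl)) (sym (flat q<n refl)) ≤-refl)
    where
    d = f (suc p)
    e = f p
    p<n = <-trans ≤-refl q<n
    d<e = descent q<n t
    d<n = bound q<n
    e<n = bound p<n
    fq<fp′ = ascent (≤-<-trans q<fq d<n) (notSucc {p} t)
    p′<d : 2 + p < d
    p′<d = ≤∧≢⇒< q<fq λ p′≡d → <-asym q<fq
      (<-≤-trans fq<fp′ (≤-reflexive (trans (cong f p′≡d) (flat q<n refl))))

  -- Both `o` and `p` have arcs over the fixed point `1 + p`. If the arc of `o` ends first, then
  -- `o`, `p`, `1 + p`, `f o` carry a 3421; if that of `p` does, the ascent to `2 + p` makes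
  -- `1 + p`, `2 + p`, `f p`, `f o` carry one.
  no-nested-opening : ∀ {o p} → peak b p ≡ true → suc p < n → o < p → f (1 + p) ≡ 1 + p →
    2 + p ≤ f o → ⊥
  no-nested-opening {o} {p} t q<n o<p fq≡q q<fo with <-cmp (f o) (f p)
  ... | tri< fo<fp _ _ = avoids3421 o<p ≤-refl q<fo (bound o<n) fo<fp
    (≤-<-trans (≤-reflexive fq≡q) q<fo)
    (subst₂ _<_ (sym (invol o<n)) (sym fq≡q) (m<n⇒m<1+n o<p))
    where o<n = <-trans o<p (<-trans ≤-refl q<n)
  ... | tri≈ _ fo≡fp _ = <⇒≢ o<p (injective (<-trans o<p p<n) p<n fo≡fp)
    where p<n = <-trans ≤-refl q<n
  ... | tri> _ _ fp<fo = avoids3421 ≤-refl p′<fp fp<fo (bound o<n) fq<fp′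
    (subst₂ _<_ (sym (invol p<n)) (sym fq≡q) ≤-refl)
    (subst₂ _<_ (sym (invol o<n)) (sym (invol p<n)) o<p)
    where
    p<n = <-trans ≤-refl q<n
    o<n = <-trans o<p p<n
    q<fp : 1 + p < f p
    q<fp = ≤-<-trans (≤-reflexive (sym fq≡q)) (descent q<n t)
    fq<fp′ = ascent (≤-<-trans q<fp (bound p<n)) (notSucc {p} t)
    p′<fp : 2 + p < f p
    p′<fp = ≤∧≢⇒< q<fp λ p′≡fp → <-asym (n<1+n p)
      (subst₂ _<_ fq≡q (trans (cong f p′≡fp) (invol p<n)) fq<fp′)

  -- A single last position would have to end the arc and so have value `o`, too small for the
  -- ascent into it. After a crossing `f (1 + p)` lies below the new left end, and this obstruction
  -- disappears.
  no-final-closer : ∀ {k o p} → peak b p ≡ true → k + (2 + p) ≡ n → o < n → 2 + p ≤ f o →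
    o ≤ f (1 + p) → k ≢ 1
  no-final-closer {o = o} {p} t refl o<n p′≤fo o≤fq refl =
    <⇒≱ (ascent ≤-refl (notSucc {p} t)) (≤-trans (≤-reflexive fp′≡o) o≤fq)
    where
    fp′≡o : f (2 + p) ≡ o
    fp′≡o = flat o<n (≤-antisym (≤-pred (bound o<n)) p′≤fo)

  lowBut-cons : ∀ {o p} → (∀ {i} → i < p → i ≢ o → f i < 2 + p) →
    (p ≢ o → f p < 2 + p) → f (1 + p) < 2 + p → LowBut o (2 + p)
  lowBut-cons before at after {i} i<p′ i≢o with i <? _
  ... | yes i<p = before i<p i≢o
  ... | no i≮p with ≤-split (≮⇒≥ i≮p)
  ...   | inj₁ refl = at i≢o
  ...   | inj₂ (inj₁ refl) = after
  ...   | inj₂ (inj₂ p′≤i) = contradiction i<p′ (≤⇒≯ p′≤i)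

  <⇒<2+ : ∀ {i p} → i < p → i < 2 + p
  <⇒<2+ l = m<n⇒m<1+n (m<n⇒m<1+n l)

  -- The smaller entry of the pair decides: `p` gives a `swap`, `1 + p` an `opening` if no arc is
  -- open, and `o` leaves `close` or `cross` to be told apart by `f p`. Every other value produces a
  -- 3421.
  parseFree : ∀ k p → peak b p ≡ true → k + p ≡ n → Low p → Σ (Free k) λ w → FollowsFree f w p
  parseUnder : ∀ k p o → peak b p ≡ true → k + p ≡ n → o < p → p ≤ f o → LowBut o p → k ≢ 1 →
    Σ (Under k) λ w → FollowsUnder f w p o
  parseFresh : ∀ k p o → peak b p ≡ true → k + p ≡ n → o < p → p ≤ f o → LowBut o p →
    Σ (Fresh k) λ w → FollowsFresh f w p o

  parseFree 0 p t e low = done , tt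
  parseFree 1 p t refl low = fix , ≤-antisym (≤-pred (bound ≤-refl)) (high low ≤-refl ≤-refl)
  parseFree (suc (suc k)) p t e low = go (≤-split (high low (n≤1+n p) q<n))
    where
    e′ = step² k e
    q<n = k+p≡n⇒p≤n k e′
    p<n = <-trans ≤-refl q<n
    go : f (1 + p) ≡ p ⊎ f (1 + p) ≡ 1 + p ⊎ 2 + p ≤ f (1 + p) →
      Σ (Free (2 + k)) λ w → FollowsFree f w p
    go (inj₁ fq≡p) =
      let w , r = parseFree k (2 + p) (top² {p} t) e′ (low-swap p<n (flat q<n fq≡p) low)
      in swap w , (flat q<n fq≡p , fq≡p) , r
    go (inj₂ (inj₁ fq≡q)) =
      let w , r = parseUnder k (2 + p) p (top² {p} t) e′ (m<n⇒m<1+n ≤-refl) p′≤fp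
                    (lowBut-cons (λ l _ → <⇒<2+ (low l)) (λ p≢p → contradiction refl p≢p)
                      (≤-reflexive (cong suc fq≡q)))
                    (no-final-closer t e′ p<n p′≤fp (≤-trans (n≤1+n p) (≤-reflexive (sym fq≡q))))
      in opening w , fq≡q , r
      where
      p′≤fp : 2 + p ≤ f p
      p′≤fp = ≤-<-trans (≤-reflexive (sym fq≡q)) (descent q<n t)
    go (inj₂ (inj₂ q<fq)) = ⊥-elim (no-double-excedance t q<n q<fq)

  parseUnder 0 p o t refl o<p p≤fo low k≢1 = contradiction (bound o<p) (≤⇒≯ p≤fo)
  parseUnder 1 p o t e o<p p≤fo low k≢1 = contradiction refl k≢1
  parseUnder (suc (suc k)) p o t e o<p p≤fo low k≢1 with f (1 + p) ≟ o
  ... | yes fq≡o = go (≤-split (highBut low ≤-refl p<n fp≢o))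
    where
    e′ = step² k e
    q<n = k+p≡n⇒p≤n k e′
    p<n = <-trans ≤-refl q<n
    fo≡q = flat q<n fq≡o
    fp≢o : f p ≢ o
    fp≢o fp≡o = <⇒≢ (n<1+n p) (injective p<n q<n (trans fp≡o (sym fq≡o)))
    fq<p′ : f (1 + p) < 2 + p
    fq<p′ = ≤-<-trans (≤-reflexive fq≡o) (<⇒<2+ o<p)
    earlier : ∀ {i} → i < p → f i < 2 + p
    earlier {i} i<p with i ≟ o
    ... | yes refl = ≤-reflexive (cong suc fo≡q)
    ... | no i≢o = <⇒<2+ (low i<p i≢o)
    go : f p ≡ p ⊎ f p ≡ 1 + p ⊎ 2 + p ≤ f p → Σ (Under (2 + k)) λ w → FollowsUnder f w p o
    go (inj₁ fp≡p) =
      let w , r = parseFree k (2 + p) (top² {p} t) e′ λ {i} i<p′ →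
                    -- The exception `2 + p` lies outside the range, so nothing is excepted and the
                    -- result amounts to `Low (2 + p)`.
                    lowBut-cons {o = 2 + p} (λ l _ → earlier l)
                      (λ _ → ≤-<-trans (≤-reflexive fp≡p) (m<n⇒m<1+n ≤-refl)) fq<p′ i<p′ (<⇒≢ i<p′)
      in close w , fp≡p , (fo≡q , fq≡o) , r
    go (inj₂ (inj₁ fp≡q)) =
      contradiction (trans (sym fq≡o) (flat p<n fp≡q)) (<⇒≢ o<p)
    go (inj₂ (inj₂ p′≤fp)) =
      let w , r = parseFresh k (2 + p) p (top² {p} t) e′ (m<n⇒m<1+n ≤-refl) p′≤fp
                    (lowBut-cons (λ l _ → earlier l) (λ p≢p → contradiction refl p≢p) fq<p′)
      in cross w , (fo≡q , fq≡o) , r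
  ... | no fq≢o = go (≤-split p≤fq)
    where
    e′ = step² k e
    q<n = k+p≡n⇒p≤n k e′
    p<n = <-trans ≤-refl q<n
    o<n = <-trans o<p p<n
    p≤fq = highBut low (n≤1+n p) q<n fq≢o
    fp≢o : f p ≢ o
    fp≢o fp≡o = <-asym o<p (≤-<-trans p≤fq (<-≤-trans (descent q<n t) (≤-reflexive fp≡o)))
    p′≤fo : 2 + p ≤ f o
    p′≤fo with ≤-split p≤fo
    ... | inj₁ fo≡p = contradiction (flat o<n fo≡p) fp≢o
    ... | inj₂ (inj₁ fo≡q) = contradiction (flat o<n fo≡q) fq≢o
    ... | inj₂ (inj₂ l) = l
    go : f (1 + p) ≡ p ⊎ f (1 + p) ≡ 1 + p ⊎ 2 + p ≤ f (1 + p) →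
      Σ (Under (2 + k)) λ w → FollowsUnder f w p o
    go (inj₁ fq≡p) =
      let w , r = parseUnder k (2 + p) o (top² {p} t) e′ (<⇒<2+ o<p) p′≤fo
                    (lowBut-cons (λ l i≢o → <⇒<2+ (low l i≢o))
                      (λ _ → ≤-reflexive (cong suc (flat q<n fq≡p)))
                      (≤-<-trans (≤-reflexive fq≡p) (m<n⇒m<1+n ≤-refl)))
                    (no-final-closer t e′ o<n p′≤fo (≤-trans (<⇒≤ o<p) p≤fq))
      in swap w , (flat q<n fq≡p , fq≡p) , r
    go (inj₂ (inj₁ fq≡q)) = ⊥-elim (no-nested-opening t q<n o<p fq≡q p′≤fo)
    go (inj₂ (inj₂ q<fq)) = ⊥-elim (no-double-excedance t q<n q<fq)

  parseFresh 0 p o t refl o<p p≤fo low = contradiction (bound o<p) (≤⇒≯ p≤fo)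
  parseFresh 1 p o t refl o<p p≤fo low = fin , fo≡p , flat o<n fo≡p
    where
    o<n = m<n⇒m<1+n o<p
    fo≡p = ≤-antisym (≤-pred (bound o<n)) p≤fo
  parseFresh k@(suc (suc _)) p o t e o<p p≤fo low =
    let w , r = parseUnder k p o t e o<p p≤fo low λ () in cont w , r

parse : ∀ {b n f} → 2 ≤ n → Valid b n f → Σ (Start b n) λ w → Follows f w
parse {true} {n} _ valid =
  let w , r = Parse.parseFree valid n 0 refl (+-identityʳ n) (λ ()) in plain w , r
parse {false} {suc k} {f} 2≤n valid with f 0 in f0≡
... | zero =
  let w , r = parseFree k 1 refl (+-comm k 1) λ { {zero} _ → ≤-reflexive (cong suc f0≡) ; {suc _} (s≤s ()) }
  in fixed w , f0≡ , r
  where open Parse valid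
-- The arc from 0 is treated as coming in to the pair at 1 and 2. The ascent `f 0 < f 1` then rules
-- out all but `cross`.
... | suc x = go (parseUnder k 1 0 refl (+-comm k 1) ≤-refl 1≤f0
                   (λ { {zero} _ 0≢0 → contradiction refl 0≢0 ; {suc _} (s≤s ()) }) k≢1)
  where
  open Valid valid
  open Parse valid
  1≤f0 : 1 ≤ f 0
  1≤f0 = ≤-trans (s≤s z≤n) (≤-reflexive (sym f0≡))
  f0<f1 = ascent 2≤n refl
  f0≢1 : f 0 ≢ 1
  f0≢1 f0≡1 = <⇒≱ f0<f1 (≤-trans (≤-reflexive (flat (s≤s z≤n) f0≡1)) z≤n)
  k≢1 : k ≢ 1
  k≢1 refl = f0≢1 (≤-antisym (≤-pred (bound (s≤s z≤n))) 1≤f0)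
  go : Σ (Under k) (λ w → FollowsUnder f w 1 0) → Σ (Start false (suc k)) λ w → Follows f w
  go (swap w , (f1≡2 , _) , _) =
    contradiction (≤-antisym (≤-pred (<-≤-trans f0<f1 (≤-reflexive f1≡2))) 1≤f0) f0≢1
  go (close w , f1≡1 , (f0≡2 , _) , _) =
    contradiction f0<f1 (≤⇒≯ (subst₂ _≤_ (sym f1≡1) (sym f0≡2) (s≤s z≤n)))
  go (cross w , r) = linked w , r

-- Permutations as functions on ℕ

peak-parity : ∀ i → (peak true i ≡ true × peak false i ≡ false × 2 ∤ suc i) ⊎
                    (peak true i ≡ false × peak false i ≡ true × 2 ∣ suc i)
peak-parity 0 = inj₁ (refl , refl , λ { (divides zero ()) ; (divides (suc _) ()) })
peak-parity 1 = inj₂ (refl , refl , divides 1 refl)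
peak-parity (suc (suc i))
  rewrite not-involutive (peak true i) | not-involutive (peak false i) with peak-parity i
... | inj₁ (t , t′ , odd) = inj₁ (t , t′ , λ even → odd (∣m+n∣m⇒∣n even ∣-refl))
... | inj₂ (t , t′ , even) = inj₂ (t , t′ , ∣m∣n⇒∣m+n ∣-refl even)

Zigzag : Bool → ∀ {n} → Permutation′ n → Set
Zigzag true = ReverseAlternating
Zigzag false = Alternating

Class : Bool → ∀ {n} → Permutation′ n → Set
Class b π = Zigzag b π × Involution π × Avoids π p3421 × Avoids π p4312

module _ {n : ℕ} where
  -- Being the identity from n on, these functions agree everywhere once the permutations agree, as
  -- `unique` demands.
  onℕ : Permutation′ n → ℕ → ℕ
  onℕ π i with i <? n
  ... | yes i<n = toℕ (π ⟨$⟩ʳ fromℕ< i<n)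
  ... | no _ = i

  onℕ-toℕ : ∀ π x → onℕ π (toℕ x) ≡ toℕ (π ⟨$⟩ʳ x)
  onℕ-toℕ π x with toℕ x <? n
  ... | yes x<n = cong (λ y → toℕ (π ⟨$⟩ʳ y)) (fromℕ<-toℕ x x<n)
  ... | no x≮n = contradiction (toℕ<n x) x≮n

  onℕ-cong : ∀ {π ρ} → (∀ x → π ⟨$⟩ʳ x ≡ ρ ⟨$⟩ʳ x) → ∀ i → onℕ π i ≡ onℕ ρ i
  onℕ-cong π≈ρ i with i <? n
  ... | yes i<n = cong toℕ (π≈ρ (fromℕ< i<n))
  ... | no _ = refl

  lift : ∀ {i} → i < n → ∃[ x ] toℕ x ≡ i
  lift i<n = fromℕ< i<n , toℕ-fromℕ< i<n

monotone₄ : (u : Fin 4 → ℕ) → u 0F < u 1F → u 1F < u 2F → u 2F < u 3F →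
  ∀ {i j} → i Fin.< j → u i < u j
monotone₄ u p q r {0F} {1F} _ = p
monotone₄ u p q r {0F} {2F} _ = <-trans p q
monotone₄ u p q r {0F} {3F} _ = <-trans p (<-trans q r)
monotone₄ u p q r {1F} {2F} _ = q
monotone₄ u p q r {1F} {3F} _ = <-trans q r
monotone₄ u p q r {2F} {3F} _ = r
monotone₄ u p q r {0F} {0F} ()
monotone₄ u p q r {1F} {0F} ()
monotone₄ u p q r {1F} {1F} (s≤s ())
monotone₄ u p q r {2F} {0F} ()
monotone₄ u p q r {2F} {1F} (s≤s ())
monotone₄ u p q r {2F} {2F} (s≤s (s≤s ()))
monotone₄ u p q r {3F} {0F} ()
monotone₄ u p q r {3F} {1F} (s≤s ())
monotone₄ u p q r {3F} {2F} (s≤s (s≤s ()))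
monotone₄ u p q r {3F} {3F} (s≤s (s≤s (s≤s ())))

monotone-reflects : ∀ {k} (u : Fin k → ℕ) → (∀ {i j} → i Fin.< j → u i < u j) →
  ∀ {i j} → u i < u j → i Fin.< j
monotone-reflects u mono {i} {j} l with <-cmp (toℕ i) (toℕ j)
... | tri< i<j _ _ = i<j
... | tri≈ _ e _ = contradiction l (<-irrefl (cong u (toℕ-injective e)))
... | tri> _ _ j<i = contradiction l (<-asym (mono j<i))

-- Listing the entries by rank, through the inverse of `τ`, reduces order-isomorphism to three
-- inequalities: a strictly increasing list also reflects the order.
contains₄ : ∀ {n} (π : Permutation′ n) (τ : Permutation′ 4) (ι : Fin 4 → Fin n) →
  ι 0F Fin.< ι 1F → ι 1F Fin.< ι 2F → ι 2F Fin.< ι 3F →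
  let u = λ a → π ⟨$⟩ʳ ι (τ ⟨$⟩ˡ a) in
  u 0F Fin.< u 1F → u 1F Fin.< u 2F → u 2F Fin.< u 3F → Contains π τ
contains₄ π τ ι p q r p′ q′ r′ = ι , monotone₄ (toℕ ∘ ι) p q r , λ a b → mk⇔
  (λ l → monotone-reflects u mono (subst₂ _<_ (sym (at a)) (sym (at b)) l))
  (λ l → subst₂ _<_ (at a) (at b) (mono l))
  where
  u : Fin 4 → ℕ
  u a = toℕ (π ⟨$⟩ʳ ι (τ ⟨$⟩ˡ a))
  mono : ∀ {i j} → i Fin.< j → u i < u j
  mono = monotone₄ u p′ q′ r′
  at : ∀ a → u (τ ⟨$⟩ʳ a) ≡ toℕ (π ⟨$⟩ʳ ι a)
  at a = cong (λ c → toℕ (π ⟨$⟩ʳ ι c)) (inverseˡ τ)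

class⇒valid : ∀ {b n} {π : Permutation′ n} → Class b π → Valid b n (onℕ π)
class⇒valid {b} {n} {π} (zig , inv , avoids , _) = record
  { bound = λ i<n → let x , e = lift i<n in
      subst (_< n) (sym (at e)) (toℕ<n (π ⟨$⟩ʳ x))
  ; invol = λ i<n → let x , e = lift i<n in
      trans (cong (onℕ π) (at e)) (trans (onℕ-toℕ π _) (trans (cong toℕ (twice x)) e))
  ; descent = λ {i} si<n t → let x , e = lift (<-trans (n<1+n i) si<n) ; y , e′ = lift si<n in
      subst₂ _<_ (sym (at e′)) (sym (at e))
        (down zig x y (trans e′ (cong suc (sym e))) (subst (λ z → peak b z ≡ true) (sym e) t))
  ; ascent = λ {i} si<n t → let x , e = lift (<-trans (n<1+n i) si<n) ; y , e′ = lift si<n in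
      subst₂ _<_ (sym (at e)) (sym (at e′))
        (up zig x y (trans e′ (cong suc (sym e))) (subst (λ z → peak b z ≡ false) (sym e) t))
  ; avoids3421 = λ a<b b<c c<d d<n fa<fb fc<fa fd<fc →
      let c<n = <-trans c<d d<n ; b<n = <-trans b<c c<n ; a<n = <-trans a<b b<n
          w , w≡ = lift a<n ; x , x≡ = lift b<n ; y , y≡ = lift c<n ; z , z≡ = lift d<n
      in avoids (contains₄ π p3421 (lookup (w ∷ x ∷ y ∷ z ∷ []))
           (subst₂ _<_ (sym w≡) (sym x≡) a<b)
           (subst₂ _<_ (sym x≡) (sym y≡) b<c)
           (subst₂ _<_ (sym y≡) (sym z≡) c<d)
           (subst₂ _<_ (at z≡) (at y≡) fd<fc)
           (subst₂ _<_ (at y≡) (at w≡) fc<fa)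
           (subst₂ _<_ (at w≡) (at x≡) fa<fb))
  }
  where
  at : ∀ {x i} → toℕ x ≡ i → onℕ π i ≡ toℕ (π ⟨$⟩ʳ x)
  at {x} refl = onℕ-toℕ π x
  twice : ∀ x → π ⟨$⟩ʳ (π ⟨$⟩ʳ x) ≡ x
  twice x = trans (cong (π ⟨$⟩ʳ_) (inv x)) (inverseʳ π)
  -- At even places the parity condition only denies one strict inequality; distinctness of
  -- neighbours then gives the opposite one.
  values≢ : ∀ {x y} → toℕ y ≡ suc (toℕ x) → toℕ (π ⟨$⟩ʳ x) ≢ toℕ (π ⟨$⟩ʳ y)
  values≢ {x} {y} e e′ = 1+n≢n (trans (sym e) (cong toℕ
    (trans (sym (twice y)) (trans (cong (π ⟨$⟩ʳ_) (sym (toℕ-injective e′))) (twice x)))))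
  down : ∀ {b} → Zigzag b π → ∀ x y → toℕ y ≡ suc (toℕ x) → peak b (toℕ x) ≡ true →
    π ⟨$⟩ʳ y Fin.< π ⟨$⟩ʳ x
  down {true} h x y e t with peak-parity (toℕ x)
  ... | inj₁ (_ , _ , odd) = Equivalence.from (h x y e) odd
  ... | inj₂ (t′ , _) = case trans (sym t) t′ of λ ()
  down {false} h x y e t with peak-parity (toℕ x)
  ... | inj₁ (_ , t′ , _) = case trans (sym t) t′ of λ ()
  ... | inj₂ (_ , _ , even) =
    ≤∧≢⇒< (≮⇒≥ λ l → Equivalence.to (h x y e) l even) (values≢ e ∘ sym)
  up : ∀ {b} → Zigzag b π → ∀ x y → toℕ y ≡ suc (toℕ x) → peak b (toℕ x) ≡ false →
    π ⟨$⟩ʳ x Fin.< π ⟨$⟩ʳ y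
  up {true} h x y e t with peak-parity (toℕ x)
  ... | inj₁ (t′ , _) = case trans (sym t) t′ of λ ()
  ... | inj₂ (_ , _ , even) =
    ≤∧≢⇒< (≮⇒≥ λ l → Equivalence.to (h x y e) l even) (values≢ e)
  up {false} h x y e t with peak-parity (toℕ x)
  ... | inj₁ (_ , _ , odd) = Equivalence.from (h x y e) odd
  ... | inj₂ (_ , t′ , _) = case trans (sym t) t′ of λ ()

-- From functions back to permutations

module _ {b n f} (valid : Valid b n f) where
  open Valid valid

  onFin : Fin n → Fin n
  onFin x = fromℕ< (bound (toℕ<n x))

  toℕ-onFin : ∀ x → toℕ (onFin x) ≡ f (toℕ x)
  toℕ-onFin x = toℕ-fromℕ< _

  onFin-involutive : ∀ x → onFin (onFin x) ≡ x
  onFin-involutive x = toℕ-injective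
    (trans (toℕ-onFin (onFin x)) (trans (cong f (toℕ-onFin x)) (invol (toℕ<n x))))

  toPermutation : Permutation′ n
  toPermutation = permutation onFin onFin onFin-involutive onFin-involutive

  onℕ-toPermutation : ∀ i → i < n → onℕ toPermutation i ≡ f i
  onℕ-toPermutation i i<n with lift i<n
  ... | x , refl = trans (onℕ-toℕ toPermutation x) (toℕ-onFin x)

  <-onFin : ∀ {x y} → onFin x Fin.< onFin y → f (toℕ x) < f (toℕ y)
  <-onFin {x} {y} = subst₂ _<_ (toℕ-onFin x) (toℕ-onFin y)

  onFin-< : ∀ {x y} → f (toℕ x) < f (toℕ y) → onFin x Fin.< onFin y
  onFin-< {x} {y} = subst₂ _<_ (sym (toℕ-onFin x)) (sym (toℕ-onFin y))

  toPermutation-avoids3421 : Avoids toPermutation p3421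
  toPermutation-avoids3421 (ι , mono , iff) = avoids3421
    (mono {0F} {1F} ≤-refl) (mono {1F} {2F} ≤-refl) (mono {2F} {3F} ≤-refl) (toℕ<n (ι 3F))
    (<-onFin (Equivalence.from (iff 0F 1F) ≤-refl))
    (<-onFin (Equivalence.from (iff 2F 0F) ≤-refl))
    (<-onFin (Equivalence.from (iff 3F 2F) ≤-refl))

  toPermutation-avoids4312 : Avoids toPermutation p4312
  toPermutation-avoids4312 (ι , mono , iff) = avoids4312
    (mono {0F} {1F} ≤-refl) (mono {1F} {2F} ≤-refl) (mono {2F} {3F} ≤-refl) (toℕ<n (ι 3F))
    (<-onFin (Equivalence.from (iff 1F 0F) ≤-refl))
    (<-onFin (Equivalence.from (iff 3F 1F) ≤-refl))
    (<-onFin (Equivalence.from (iff 2F 3F) ≤-refl))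

toPermutation-zigzag : ∀ {b n f} (valid : Valid b n f) → Zigzag b (toPermutation valid)
toPermutation-zigzag {true} {n} {f} valid x y e with peak-parity (toℕ x)
... | inj₁ (t , _ , odd) = mk⇔ (λ _ → odd) λ _ → onFin-< valid
  (subst (λ z → f z < f (toℕ x)) (sym e) (Valid.descent valid (subst (_< n) e (toℕ<n y)) t))
... | inj₂ (t , _ , even) = mk⇔
  (λ l → contradiction (<-onFin valid l) (<-asym
    (subst (λ z → f (toℕ x) < f z) (sym e) (Valid.ascent valid (subst (_< n) e (toℕ<n y)) t))))
  (λ odd → contradiction even odd)
toPermutation-zigzag {false} {n} {f} valid x y e with peak-parity (toℕ x)
... | inj₁ (_ , t , odd) = mk⇔ (λ _ → odd) λ _ → onFin-< valid
  (subst (λ z → f (toℕ x) < f z) (sym e) (Valid.ascent valid (subst (_< n) e (toℕ<n y)) t))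
... | inj₂ (_ , t , even) = mk⇔
  (λ l → contradiction (<-onFin valid l) (<-asym
    (subst (λ z → f z < f (toℕ x)) (sym e) (Valid.descent valid (subst (_< n) e (toℕ<n y)) t))))
  (λ odd → contradiction even odd)

valid⇒class : ∀ {b n f} (valid : Valid b n f) → Class b (toPermutation valid)
valid⇒class valid = toPermutation-zigzag valid , (λ _ → refl) ,
  toPermutation-avoids3421 valid , toPermutation-avoids4312 valid

-- Encoding a decoded word returns it by `unique`; decoding an encoded permutation returns the same
-- values by `agree`.
class↔start : ∀ b {n} → 2 ≤ n → Inverse ⟪ Class b {n} ⟫ (setoid (Start b n))
class↔start b {n} 2≤n = record
  { to = encode
  ; from = decode
  ; to-cong = λ {π} {ρ} π≈ρ →
      unique (onℕ-cong π≈ρ) (encode π) (encode ρ) (encode-follows π) (encode-follows ρ)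
  ; from-cong = λ { refl _ → refl }
  ; inverse = (λ {w} {π} → encode∘decode {w} {π}) , (λ {π} {w} → decode∘encode {π} {w})
  }
  where
  encode : ∃ (Class b {n}) → Start b n
  encode (π , c) = proj₁ (parse 2≤n (class⇒valid {b} {π = π} c))
  encode-follows : ∀ π → Follows (onℕ (proj₁ π)) (encode π)
  encode-follows (π , c) = proj₂ (parse 2≤n (class⇒valid {b} {π = π} c))
  valid : ∀ w → Valid b n (value w)
  valid w = follows⇒valid w (value-follows w λ _ _ → refl)
  decode : Start b n → ∃ (Class b {n})
  decode w = toPermutation (valid w) , valid⇒class (valid w)
  encode∘decode : ∀ {w π} → (∀ x → proj₁ π ⟨$⟩ʳ x ≡ proj₁ (decode w) ⟨$⟩ʳ x) → encode π ≡ w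
  encode∘decode {w} {π} π≈ = unique (onℕ-cong π≈) (encode π) w (encode-follows π)
    (value-follows w (onℕ-toPermutation (valid w)))
  decode∘encode : ∀ {π w} → w ≡ encode π → ∀ x → proj₁ (decode w) ⟨$⟩ʳ x ≡ proj₁ π ⟨$⟩ʳ x
  decode∘encode {π} refl x = toℕ-injective (trans (toℕ-onFin (valid w) x)
    (trans (agree w (value-follows w λ _ _ → refl) (encode-follows π) (toℕ x) (toℕ<n x))
      (onℕ-toℕ (proj₁ π) x)))
    where w = encode π

-- At n = 1 there is one word of either kind while `F 0` is 0, so the count starts at 2.
card-class : ∀ b n → 2 ≤ n → HasCardinality ⟪ Class b {n} ⟫ (F (n ∸ 1))
card-class b (suc zero) (s≤s ())
card-class b (suc (suc k)) 2≤n = inverse (class↔start b 2≤n) (card-start b k)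

theorem8p1 : ∀ (n : ℕ) → 2 ≤ n →
    HasCardinality (AI n p3421 p4312) (F (n ∸ 1)) ×
    HasCardinality (RAI n p3421 p4312) (F (n ∸ 1))
theorem8p1 n 2≤n = card-class false n 2≤n , card-class true n 2≤n
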